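{- Let $H$ be a non-empty 3-graph (one having at least one 3-edge), and let $F(H)$ be the co-spanned $H$. Then \[\gamma(F(H))\leq \frac{1}{2-\gamma(H)},\] where $\gamma$ denotes codegree density.
   Context: A 3-graph is a pair $G=(V,E)$ with $V$ a finite vertex set and $E$ a set of 3-element subsets of $V$ (the 3-edges). A 3-graph contains another 3-graph $F$ as a subgraph if it has a (not necessarily induced) subgraph isomorphic to $F$. Given a 3-graph $H$, the co-spanned $H$, denoted $F(H)$, is the 3-graph with vertex set $V(H)\sqcup\{x_\star,y_\star\}$ and 3-edge set $\{x_\star y_\star v: v\in V(H)\}\sqcup E(H)$. For a family $\mathcal{F}$ of non-empty 3-graphs, the codegree threshold $\mathrm{coex}(n,\mathcal{F})$ is the largest integer $d$ such that there exists an $n$-vertex 3-graph in which every pair of distinct vertices is contained in at least $d$ 3-edges and which contains no member of $\mathcal{F}$ as a subgraph. The codegree density of $\mathcal{F}$ is $\gamma(\mathcal{F})=\lim_{n\to\infty}\frac{\mathrm{coex}(n,\mathcal{F})}{n-2}$; this limit is known to exist for every such $\mathcal{F}$ (Mubayi and Zhao). For a single 3-graph $F$, write $\gamma(F)=\gamma(\{F\})$. -}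

module Defs where

open import Data.Bool.Base using (Bool; true; false; T; _xor_)
open import Data.Bool.Properties using (xor-comm)
open import Data.Fin.Base using (Fin; zero; suc)
import Data.Fin.Subset as Subset
open import Data.Fin.Subset using (Subset)
open import Data.Fin.Subset.Properties using (∣p∣≤n)
open import Data.Integer.Base as ℤ using (+_)
import Data.Integer.Properties as ℤ
open import Data.Nat.Base as ℕ using (ℕ; suc)
import Data.Nat.Properties as ℕ
open import Data.Product.Base using (Σ-syntax; ∃-syntax; _×_; _,_; proj₁; proj₂)
open import Data.Rational.Base as ℚ
  using (ℚ; 0ℚ; ½; _+_; _*_; _-_; -_; ∣_∣; _≤_; _/_; _⊔_; Positive)
open import Data.Rational.Properties
open import Data.Rational.Solver using (module +-*-Solver)
import Data.Rational.Unnormalised.Base as ℚᵘ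
import Data.Rational.Unnormalised.Properties as ℚᵘ
open import Data.Sum.Base using (_⊎_; inj₁; inj₂)
open import Data.Vec.Base using (tabulate)
open import Function.Definitions using (Injective)
open import Relation.Binary.PropositionalEquality
  using (_≡_; _≢_; refl; sym; cong; subst)
open import Relation.Nullary.Negation using (¬_)

-- A set of 3-element subsets of V, given by its indicator function on
-- triples: {x, y, z} is a 3-edge iff edge x y z holds.  By symmetry,
-- edge-distinct makes all three vertices of a 3-edge distinct.
record ThreeGraph (V : Set) : Set where
  field
    edge          : V → V → V → Bool
    edge-swap     : ∀ x y z → edge x y z ≡ edge y x z
    edge-rotate   : ∀ x y z → edge x y z ≡ edge y z x
    edge-distinct : ∀ x y z → T (edge x y z) → x ≢ y

open ThreeGraph public

NonEmpty : {V : Set} → ThreeGraph V → Set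
NonEmpty G = ∃[ x ] ∃[ y ] ∃[ z ] T (edge G x y z)

infix 4 _Contains_

_Contains_ : {V W : Set} → ThreeGraph V → ThreeGraph W → Set
_Contains_ {V} {W} G F = Σ[ f ∈ (W → V) ] Injective _≡_ _≡_ f ×
  (∀ x y z → T (edge F x y z) → T (edge G (f x) (f y) (f z)))

-- The new vertices are x⋆ = inj₂ false and y⋆ = inj₂ true, so that
-- inj₂ i and inj₂ j are the two of them precisely when i xor j.
module _ {V : Set} (H : ThreeGraph V) where

  coEdge : (x y z : V ⊎ Bool) → Bool
  coEdge (inj₁ u) (inj₁ v) (inj₁ w) = edge H u v w
  coEdge (inj₂ i) (inj₂ j) (inj₁ v) = i xor j
  coEdge (inj₂ i) (inj₁ v) (inj₂ j) = i xor j
  coEdge (inj₁ v) (inj₂ i) (inj₂ j) = i xor j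
  coEdge (inj₁ u) (inj₁ v) (inj₂ i) = false
  coEdge (inj₁ u) (inj₂ i) (inj₁ v) = false
  coEdge (inj₂ i) (inj₁ u) (inj₁ v) = false
  coEdge (inj₂ i) (inj₂ j) (inj₂ k) = false

  coSpanned : ThreeGraph (V ⊎ Bool)
  coSpanned .edge = coEdge
  coSpanned .edge-swap (inj₁ u) (inj₁ v) (inj₁ w) = edge-swap H u v w
  coSpanned .edge-swap (inj₂ i) (inj₂ j) (inj₁ v) = xor-comm i j
  coSpanned .edge-swap (inj₂ i) (inj₁ v) (inj₂ j) = refl
  coSpanned .edge-swap (inj₁ v) (inj₂ i) (inj₂ j) = refl
  coSpanned .edge-swap (inj₁ u) (inj₁ v) (inj₂ i) = refl
  coSpanned .edge-swap (inj₁ u) (inj₂ i) (inj₁ v) = refl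
  coSpanned .edge-swap (inj₂ i) (inj₁ u) (inj₁ v) = refl
  coSpanned .edge-swap (inj₂ i) (inj₂ j) (inj₂ k) = refl
  coSpanned .edge-rotate (inj₁ u) (inj₁ v) (inj₁ w) = edge-rotate H u v w
  coSpanned .edge-rotate (inj₂ i) (inj₂ j) (inj₁ v) = xor-comm i j
  coSpanned .edge-rotate (inj₂ i) (inj₁ v) (inj₂ j) = xor-comm i j
  coSpanned .edge-rotate (inj₁ v) (inj₂ i) (inj₂ j) = refl
  coSpanned .edge-rotate (inj₁ u) (inj₁ v) (inj₂ i) = refl
  coSpanned .edge-rotate (inj₁ u) (inj₂ i) (inj₁ v) = refl
  coSpanned .edge-rotate (inj₂ i) (inj₁ u) (inj₁ v) = refl
  coSpanned .edge-rotate (inj₂ i) (inj₂ j) (inj₂ k) = refl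
  coSpanned .edge-distinct (inj₁ u) (inj₁ v) (inj₁ w) e refl =
    edge-distinct H u v w e refl
  coSpanned .edge-distinct (inj₂ false) (inj₂ .false) (inj₁ v) () refl
  coSpanned .edge-distinct (inj₂ true)  (inj₂ .true)  (inj₁ v) () refl

neighbourhood : ∀ {n} → ThreeGraph (Fin n) → (u v : Fin n) → Subset n
neighbourhood G u v = tabulate (edge G u v)

-- For u ≢ v the 3-edges containing u and v are the sets {u, v, w} with w
-- in the neighbourhood.
codegree : ∀ {n} → ThreeGraph (Fin n) → (u v : Fin n) → ℕ
codegree G u v = Subset.∣ neighbourhood G u v ∣

MinCodegree≥ : ∀ {n} → ThreeGraph (Fin n) → ℕ → Set
MinCodegree≥ G d = ∀ u v → u ≢ v → d ℕ.≤ codegree G u v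

Achieves : {W : Set} → ℕ → ThreeGraph W → ℕ → Set
Achieves n F d =
  Σ[ G ∈ ThreeGraph (Fin n) ] MinCodegree≥ G d × ¬ (G Contains F)

IsCoex : {W : Set} → ℕ → ThreeGraph W → ℕ → Set
IsCoex n F d = Achieves n F d × (∀ d′ → Achieves n F d′ → d′ ℕ.≤ d)

private

  p≤∣p∣ : ∀ p → p ≤ ∣ p ∣
  p≤∣p∣ p with ≤-total 0ℚ p
  ... | inj₁ 0≤p = ≤-reflexive (sym (0≤p⇒∣p∣≡p 0≤p))
  ... | inj₂ p≤0 = ≤-trans p≤0 (0≤∣p∣ p)

  ∣p∣≤ : ∀ {p e} → p ≤ e → - p ≤ e → ∣ p ∣ ≤ e
  ∣p∣≤ {p} p≤e -p≤e with ∣p∣≡p∨∣p∣≡-p p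
  ... | inj₁ eq = ≤-trans (≤-reflexive eq) p≤e
  ... | inj₂ eq = ≤-trans (≤-reflexive eq) -p≤e

  open +-*-Solver

  neg-minus : ∀ p q → - (p - q) ≡ q - p
  neg-minus = solve 2 (λ p q → :- (p :- q) := q :- p) refl

  minus-plus : ∀ p q → p ≡ q + (p - q)
  minus-plus = solve 2 (λ p q → p := q :+ (p :- q)) refl

  plus-minus : ∀ p q → (q + p) - q ≡ p
  plus-minus = solve 2 (λ p q → (q :+ p) :- q := p) refl

  minus≤ : ∀ {p q e} → p ≤ q + e → p - q ≤ e
  minus≤ {p} {q} {e} h =
    ≤-trans (+-monoˡ-≤ (- q) h) (≤-reflexive (plus-minus e q))

  ≤plus : ∀ {p q e} → p - q ≤ e → p ≤ q + e
  ≤plus {p} {q} h =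
    ≤-trans (≤-reflexive (minus-plus p q)) (+-monoʳ-≤ q h)

IsCauchy : (ℕ → ℚ) → Set
IsCauchy s = ∀ ε .{{_ : Positive ε}} → ∃[ N ] ∀ m n → N ℕ.≤ m → N ℕ.≤ n →
  ∣ s m - s n ∣ ≤ ε

private

  OneSided : (ℕ → ℚ) → Set
  OneSided s = ∀ ε .{{_ : Positive ε}} → ∃[ N ] ∀ m n → N ℕ.≤ m → N ℕ.≤ n →
    s m ≤ s n + ε

  fromOneSided : ∀ s → OneSided s → IsCauchy s
  fromOneSided s h ε = let N , b = h ε in N , λ m n N≤m N≤n →
    ∣p∣≤ (minus≤ {s m} {s n} (b m n N≤m N≤n))
         (subst (_≤ ε) (sym (neg-minus (s m) (s n)))
           (minus≤ {s n} {s m} (b n m N≤n N≤m)))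

  toOneSided : ∀ s → IsCauchy s → OneSided s
  toOneSided s h ε = let N , b = h ε in N , λ m n N≤m N≤n →
    ≤plus {s m} {s n} (≤-trans (p≤∣p∣ (s m - s n)) (b m n N≤m N≤n))

record ℝ : Set where
  constructor real
  field
    seq    : ℕ → ℚ
    cauchy : IsCauchy seq

open ℝ public

infixl 6 _-ᵣ_
infix  4 _≤ᵣ_ _<ᵣ_ _⟶_

fromℚ : ℚ → ℝ
fromℚ q = real (λ _ → q) (fromOneSided (λ _ → q) λ ε → 0 , λ _ _ _ _ →
  ≤-trans (≤-reflexive (sym (+-identityʳ q)))
          (+-monoʳ-≤ q (<⇒≤ (positive⁻¹ ε))))

_≤ᵣ_ : ℝ → ℝ → Set
x ≤ᵣ y = ∀ ε .{{_ : Positive ε}} → ∃[ N ] ∀ n → N ℕ.≤ n →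
  seq x n ≤ seq y n + ε

_<ᵣ_ : ℝ → ℝ → Set
x <ᵣ y = Σ[ δ ∈ ℚ ] Positive δ × ∃[ N ] ∀ n → N ℕ.≤ n →
  seq x n + δ ≤ seq y n

private

  half : ∀ ε .{{_ : Positive ε}} → Positive (½ * ε)
  half ε = pos*pos⇒pos ½ ε

  minus-mono : ∀ a a′ b b′ ε → a ≤ a′ + ½ * ε → b′ ≤ b + ½ * ε →
               a - b ≤ (a′ - b′) + ε
  minus-mono a a′ b b′ ε p q = begin
    a - b                               ≡⟨ eq₁ a b b′ ⟩
    (a + b′) + (- b - b′)               ≤⟨ +-monoˡ-≤ (- b - b′) (+-mono-≤ p q) ⟩
    (a′ + ½ * ε) + (b + ½ * ε) + (- b - b′)  ≡⟨ eq₂ a′ b b′ ε ⟩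
    (a′ - b′) + ε                       ∎
    where
    open ≤-Reasoning
    eq₁ : ∀ a b b′ → a - b ≡ (a + b′) + (- b - b′)
    eq₁ = solve 3 (λ a b b′ → a :- b := (a :+ b′) :+ (:- b :- b′)) refl
    eq₂ : ∀ a′ b b′ ε →
          (a′ + ½ * ε) + (b + ½ * ε) + (- b - b′) ≡ (a′ - b′) + ε
    eq₂ = solve 4 (λ a′ b b′ ε →
      (a′ :+ con ½ :* ε) :+ (b :+ con ½ :* ε) :+ (:- b :- b′)
        := (a′ :- b′) :+ ε) refl

_-ᵣ_ : ℝ → ℝ → ℝ
x -ᵣ y = real s (fromOneSided s λ ε → let instance _ = half ε in
  let M , f = toOneSided (seq x) (cauchy x) (½ * ε)
      N , g = toOneSided (seq y) (cauchy y) (½ * ε)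
  in M ℕ.⊔ N , λ m n ≤m ≤n →
    minus-mono (seq x m) (seq x n) (seq y m) (seq y n) ε
      (f m n (ℕ.m⊔n≤o⇒m≤o M N ≤m) (ℕ.m⊔n≤o⇒m≤o M N ≤n))
      (g n m (ℕ.m⊔n≤o⇒n≤o M N ≤n) (ℕ.m⊔n≤o⇒n≤o M N ≤m)))
  where
  s : ℕ → ℚ
  s n = seq x n - seq y n

∣_∣ᵣ : ℝ → ℝ
∣ x ∣ᵣ = real s (fromOneSided s λ ε →
  let N , f = cauchy x ε in N , λ m n ≤m ≤n → begin
    ∣ seq x m ∣                            ≡⟨ cong ∣_∣ (minus-plus (seq x m) (seq x n)) ⟩
    ∣ seq x n + (seq x m - seq x n) ∣      ≤⟨ ∣p+q∣≤∣p∣+∣q∣ (seq x n) (seq x m - seq x n) ⟩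
    ∣ seq x n ∣ + ∣ seq x m - seq x n ∣    ≤⟨ +-monoʳ-≤ ∣ seq x n ∣ (f m n ≤m ≤n) ⟩
    ∣ seq x n ∣ + ε                        ∎)
  where
  open ≤-Reasoning
  s : ℕ → ℚ
  s n = ∣ seq x n ∣

private

  ⊔-pos : ∀ δ p → Positive δ → Positive (δ ⊔ p)
  ⊔-pos δ p δ>0 = ℚ.positive (<-≤-trans (positive⁻¹ δ {{δ>0}}) (p≤p⊔q δ p))

recip⊔ : ∀ δ → Positive δ → ℚ → ℚ
recip⊔ δ δ>0 q = ℚ.1/_ (δ ⊔ q) {{pos⇒nonZero (δ ⊔ q) {{⊔-pos δ q δ>0}}}}

private

  recip-mono : ∀ δ (δ>0 : Positive δ) p q ε .{{_ : Positive ε}} →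
               q ≤ p + ε * (δ * δ) →
               recip⊔ δ δ>0 p ≤ recip⊔ δ δ>0 q + ε
  recip-mono δ δ>0 p q ε h = *-cancelʳ-≤-pos (a * b) (begin
    1/a * (a * b)           ≡⟨ sym (*-assoc 1/a a b) ⟩
    1/a * a * b             ≡⟨ cong (_* b) (*-inverseˡ a) ⟩
    ℚ.1ℚ * b                ≡⟨ *-identityˡ b ⟩
    b                       ≤⟨ b≤ ⟩
    a + ε * (δ * δ)         ≤⟨ +-monoʳ-≤ a (*-monoˡ-≤-nonNeg ε δδ≤ab) ⟩
    a + ε * (a * b)         ≡⟨ cong (_+ ε * (a * b)) (sym (*-identityˡ a)) ⟩
    ℚ.1ℚ * a + ε * (a * b)  ≡⟨ cong (λ t → t * a + ε * (a * b)) (sym (*-inverseˡ b)) ⟩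
    1/b * b * a + ε * (a * b) ≡⟨ rearrange 1/b a b ε ⟩
    (1/b + ε) * (a * b)     ∎)
    where
    open ≤-Reasoning
    a = δ ⊔ p
    b = δ ⊔ q
    instance
      posδ : Positive δ
      posδ = δ>0
      posa : Positive a
      posa = ⊔-pos δ p δ>0
      posb : Positive b
      posb = ⊔-pos δ q δ>0
      nza : ℚ.NonZero a
      nza = pos⇒nonZero a
      nzb : ℚ.NonZero b
      nzb = pos⇒nonZero b
      posab : Positive (a * b)
      posab = pos*pos⇒pos a b
      nna : ℚ.NonNegative a
      nna = pos⇒nonNeg a
      nnδ : ℚ.NonNegative δ
      nnδ = pos⇒nonNeg δ
      nnε : ℚ.NonNegative ε
      nnε = pos⇒nonNeg ε
      posη : Positive (ε * (δ * δ))
      posη = pos*pos⇒pos ε (δ * δ) {{pos*pos⇒pos δ δ}}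
    1/a = ℚ.1/ a
    1/b = ℚ.1/ b
    η = ε * (δ * δ)
    a≤a+η : a ≤ a + η
    a≤a+η = ≤-trans (≤-reflexive (sym (+-identityʳ a)))
                    (+-monoʳ-≤ a (<⇒≤ (positive⁻¹ η)))
    b≤ : b ≤ a + η
    b≤ = ⊔-lub (≤-trans (p≤p⊔q δ p) a≤a+η)
               (≤-trans h (+-monoˡ-≤ η (p≤q⊔p δ p)))
    δδ≤ab : δ * δ ≤ a * b
    δδ≤ab = ≤-trans (*-monoˡ-≤-nonNeg δ (p≤p⊔q δ q))
                    (*-monoʳ-≤-nonNeg b {{pos⇒nonNeg b}} (p≤p⊔q δ p))
    rearrange : ∀ c a b ε → c * b * a + ε * (a * b) ≡ (c + ε) * (a * b)
    rearrange = solve 4 (λ c a b ε →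
      c :* b :* a :+ ε :* (a :* b) := (c :+ ε) :* (a :* b)) refl

-- 1 / x.  A proof of 0 < x provides δ > 0 with δ ≤ seq x n eventually, and
-- the maximum taken in recip⊔ only affects the finitely many other terms.
recip : (x : ℝ) → fromℚ 0ℚ <ᵣ x → ℝ
recip x (δ , δ>0 , _) = real s (fromOneSided s λ ε →
  let instance
        posδ : Positive δ
        posδ = δ>0
        posδδ : Positive (δ * δ)
        posδδ = pos*pos⇒pos δ δ
        posη : Positive (ε * (δ * δ))
        posη = pos*pos⇒pos ε (δ * δ)
      N , f = toOneSided (seq x) (cauchy x) (ε * (δ * δ))
  in N , λ m n ≤m ≤n → recip-mono δ δ>0 (seq x m) (seq x n) ε (f n m ≤n ≤m))
  where
  s : ℕ → ℚ
  s n = recip⊔ δ δ>0 (seq x n)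

_⟶_ : (ℕ → ℚ) → ℝ → Set
r ⟶ x = ∀ ε .{{_ : Positive ε}} → ∃[ K ] ∀ k → K ℕ.≤ k →
  ∣ fromℚ (r k) -ᵣ x ∣ᵣ ≤ᵣ fromℚ ε

-- γ is the limit of coex(n, F) / (n - 2).  The sequence is indexed by
-- k = n - 3: for n ≤ 2 the quotient makes no sense, and for n ≤ 1 there is
-- no pair of vertices and hence no largest d.
IsCodegreeDensity : {W : Set} → ThreeGraph W → ℝ → Set
IsCodegreeDensity F γ =
  Σ[ coex ∈ (ℕ → ℕ) ] (∀ k → IsCoex (3 ℕ.+ k) F (coex k)) ×
    ((λ k → + coex k / suc k) ⟶ γ)

2ℝ : ℝ
2ℝ = fromℚ (+ 2 / 1)

private

  ¼ : ℚ
  ¼ = + 1 / 4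

  IsCoex⇒≤ : ∀ {W} {F : ThreeGraph W} k {d} → IsCoex (3 ℕ.+ k) F d →
             d ℕ.≤ 3 ℕ.+ k
  IsCoex⇒≤ k ((G , deg , _) , _) =
    ℕ.≤-trans (deg zero (suc zero) λ ()) (∣p∣≤n (neighbourhood G zero (suc zero)))

  ratio≤ : ∀ k d → 7 ℕ.≤ k → d ℕ.≤ 3 ℕ.+ k → + d / suc k ≤ + 5 / 4
  ratio≤ k d 7≤k d≤ = toℚᵘ-cancel-≤ (ℚᵘ.≤-trans
    (ℚᵘ.≤-reflexive (toℚᵘ-fromℚᵘ (ℚᵘ.mkℚᵘ (+ d) k)))
    (ℚᵘ.*≤* (ℤ.≤-trans (ℤ.≤-reflexive (sym (ℤ.pos-* d 4)))
      (ℤ.≤-trans (ℤ.+≤+ bound) (ℤ.≤-reflexive (ℤ.pos-* 5 (suc k)))))))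
    where
    open ℕ.≤-Reasoning
    bound : d ℕ.* 4 ℕ.≤ 5 ℕ.* suc k
    bound = begin
      d ℕ.* 4               ≤⟨ ℕ.*-monoˡ-≤ 4 d≤ ⟩
      (3 ℕ.+ k) ℕ.* 4       ≡⟨ ℕ.*-distribʳ-+ 4 3 k ⟩
      5 ℕ.+ 7 ℕ.+ k ℕ.* 4   ≤⟨ ℕ.+-monoˡ-≤ (k ℕ.* 4) (ℕ.+-monoʳ-≤ 5 7≤k) ⟩
      5 ℕ.+ k ℕ.+ k ℕ.* 4   ≡⟨ ℕ.+-assoc 5 k (k ℕ.* 4) ⟩
      5 ℕ.+ (k ℕ.+ k ℕ.* 4) ≡⟨ cong (5 ℕ.+_) (sym (ℕ.*-suc k 4)) ⟩
      5 ℕ.+ k ℕ.* 5         ≡⟨ ℕ.*-comm (suc k) 5 ⟩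
      5 ℕ.* suc k           ∎

0<2-density : {W : Set} (F : ThreeGraph W) (γ : ℝ) →
              IsCodegreeDensity F γ → fromℚ 0ℚ <ᵣ 2ℝ -ᵣ γ
0<2-density F γ (coex , isCoex , lim) = ¼ , _ , N , λ n N≤n →
  let g = seq γ n
      h : g - r ≤ ¼ + ¼
      h = ≤-trans (≤-reflexive (sym (neg-minus r g)))
          (≤-trans (p≤∣p∣ (- (r - g)))
          (≤-trans (≤-reflexive (∣-p∣≡∣p∣ (r - g))) (close n N≤n)))
      g≤ : g ≤ + 5 / 4 + (¼ + ¼)
      g≤ = ≤-trans (≤plus {g} {r} h) (+-monoˡ-≤ (¼ + ¼) r≤)
  in +-monoʳ-≤ (+ 2 / 1) (neg-antimono-≤ g≤)
  where
  K = proj₁ (lim ¼)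
  k = K ℕ.⊔ 7
  r = + coex k / suc k
  N = proj₁ (proj₂ (lim ¼) k (ℕ.m≤m⊔n K 7) ¼)
  close = proj₂ (proj₂ (lim ¼) k (ℕ.m≤m⊔n K 7) ¼)
  r≤ : r ≤ + 5 / 4
  r≤ = ratio≤ k (coex k) (ℕ.m≤n⊔m K 7) (IsCoex⇒≤ {F = F} k (isCoex k))

{-# OPTIONS --safe #-}

-- Let G be an F(H)-free 3-graph on n vertices with minimum codegree d, and
-- let S be a set of d common neighbours of two vertices.  Then G[S] is H-free,
-- and any two vertices of S have at least d − (n − d) common neighbours in S.
-- Hence 2d − n ≤ coex(d, H) ≈ γ(H) d, that is, d / n ≲ 1 / (2 − γ(H)).
module Submission where

open import Defs
open import Data.Nat using (ℕ)
open import Data.Fin using (Fin)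

open import Data.Bool.Base using (Bool; true; false; T)
open import Data.Fin.Base using (zero; suc)
open import Data.Fin.Properties using (suc-injective)
import Data.Fin.Subset as Subset
open import Data.Fin.Subset.Properties using (∣p∣≤n)
open import Data.Integer.Base as ℤ using (+_)
import Data.Integer.Properties as ℤ
import Data.Integer.Solver as ℤ
open import Data.Nat.Base as ℕ using (zero; suc; s≤s)
import Data.Nat.Properties as ℕ
open import Data.Product.Base using (Σ-syntax; ∃-syntax; _×_; _,_; proj₁; proj₂)
open import Data.Rational.Base as ℚ
  using (ℚ; mkℚ; 0ℚ; 1ℚ; ½; _+_; _*_; _-_; -_; ∣_∣; _≤_; _/_; _⊔_; _⊓_; 1/_;
         Positive; fromℚᵘ; toℚᵘ)
open import Data.Rational.Properties
open import Data.Rational.Solver using (module +-*-Solver)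
open import Data.Rational.Unnormalised.Base as ℚᵘ using (mkℚᵘ)
import Data.Rational.Unnormalised.Properties as ℚᵘ
open import Data.Sum.Base using (_⊎_; inj₁; inj₂; [_,_]′)
open import Data.Unit.Base using (tt)
open import Data.Vec.Base using (tabulate)
open import Function.Base using (_∘_)
open import Function.Definitions using (Injective)
open import Relation.Binary.PropositionalEquality
  using (_≡_; _≢_; refl; sym; trans; cong; cong₂; subst)
open import Relation.Nullary.Negation using (contradiction)

-- Choosing `d` elements of a subset of `Fin n`.

count : ∀ {n} → (Fin n → Bool) → ℕ
count p = Subset.∣ tabulate p ∣

-- The last component is |P| − (n − d) ≤ |P ∩ S| for the image S of ι.
choose : ∀ {n} (q : Fin n → Bool) d → d ℕ.≤ count q →
  Σ[ ι ∈ (Fin d → Fin n) ] Injective _≡_ _≡_ ι × (∀ i → T (q (ι i))) ×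
    (∀ p → count p ℕ.+ d ℕ.≤ n ℕ.+ count (p ∘ ι))
choose {n} q zero _ = (λ ()) , (λ {}) , (λ ()) ,
  λ p → ℕ.+-monoˡ-≤ 0 (∣p∣≤n (tabulate p))
choose {suc n} q (suc d) d≤ with q zero in q₀
... | false = suc ∘ ι , inj ∘ suc-injective , ι∈q , bound
  where
  rec = choose (q ∘ suc) (suc d) d≤
  ι   = proj₁ rec
  inj = proj₁ (proj₂ rec)
  ι∈q = proj₁ (proj₂ (proj₂ rec))
  bound : ∀ p → count p ℕ.+ suc d ℕ.≤ suc n ℕ.+ count (p ∘ suc ∘ ι)
  -- Vertex 0 lies outside the image: if `p` holds there, both sides grow by one, otherwise only the
  -- right one does.
  bound p with p zero
  ... | true  = s≤s (proj₂ (proj₂ (proj₂ rec)) (p ∘ suc))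
  ... | false = ℕ.m≤n⇒m≤1+n (proj₂ (proj₂ (proj₂ rec)) (p ∘ suc))
... | true = ι , inj , ι∈q , bound
  where
  rec = choose (q ∘ suc) d (ℕ.≤-pred d≤)
  ι : Fin (suc d) → Fin (suc n)
  ι zero    = zero
  ι (suc i) = suc (proj₁ rec i)
  inj : Injective _≡_ _≡_ ι
  inj {zero}  {zero}  _  = refl
  inj {suc i} {suc j} eq = cong suc (proj₁ (proj₂ rec) (suc-injective eq))
  ι∈q : ∀ i → T (q (ι i))
  ι∈q zero    = subst T (sym q₀) tt
  ι∈q (suc i) = proj₁ (proj₂ (proj₂ rec)) i
  bound : ∀ p → count p ℕ.+ suc d ℕ.≤ suc n ℕ.+ count (p ∘ ι)
  -- Vertex 0 is chosen, so `d` and `n` both grow by one; if `p` holds at 0, then so do both counts.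
  bound p with p zero | proj₂ (proj₂ (proj₂ rec)) (p ∘ suc)
  ... | true  | h = s≤s (ℕ.≤-trans (ℕ.≤-reflexive (ℕ.+-suc _ d))
                      (ℕ.≤-trans (s≤s h) (ℕ.≤-reflexive (sym (ℕ.+-suc n _)))))
  ... | false | h = ℕ.≤-trans (ℕ.≤-reflexive (ℕ.+-suc _ d)) (s≤s h)

-- 3-graphs induced on common neighbourhoods.

induced : {V W : Set} → ThreeGraph V → (W → V) → ThreeGraph W
induced G ι .edge x y z          = edge G (ι x) (ι y) (ι z)
induced G ι .edge-swap x y z     = edge-swap G (ι x) (ι y) (ι z)
induced G ι .edge-rotate x y z   = edge-rotate G (ι x) (ι y) (ι z)
induced G ι .edge-distinct x y z e = edge-distinct G (ι x) (ι y) (ι z) e ∘ cong ι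

module _ {V W U : Set} (G : ThreeGraph V) (H : ThreeGraph U) {x y : V} (x≢y : x ≢ y)
         (ι : W → V) (ι-injective : Injective _≡_ _≡_ ι)
         (ι∈N : ∀ w → T (edge G x y (ι w))) where

  -- Sending x⋆ and y⋆ to `x` and `y` extends a copy of `H` among their common neighbours to a copy
  -- of F(H).
  induced-contains⇒contains-coSpanned :
    induced G ι Contains H → G Contains coSpanned H
  induced-contains⇒contains-coSpanned (f , f-injective , f-edge) =
    g , g-injective , g-edge
    where
    -- The vertices of a 3-edge are distinct, so `x` and `y` are not among their own common
    -- neighbours; this keeps `g` injective.
    x≢ι : ∀ w → x ≢ ι w
    x≢ι w eq = edge-distinct G (ι w) x y
      (subst T (trans (edge-rotate G x y (ι w)) (edge-rotate G y (ι w) x)) (ι∈N w)) (sym eq)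
    y≢ι : ∀ w → y ≢ ι w
    y≢ι w = edge-distinct G y (ι w) x (subst T (edge-rotate G x y (ι w)) (ι∈N w))
    g : U ⊎ Bool → V
    g (inj₁ u)     = ι (f u)
    g (inj₂ false) = x
    g (inj₂ true)  = y
    g-injective : Injective _≡_ _≡_ g
    g-injective {inj₁ u} {inj₁ v} eq = cong inj₁ (f-injective (ι-injective eq))
    g-injective {inj₁ u} {inj₂ false} eq = contradiction (sym eq) (x≢ι (f u))
    g-injective {inj₁ u} {inj₂ true}  eq = contradiction (sym eq) (y≢ι (f u))
    g-injective {inj₂ false} {inj₁ u} eq = contradiction eq (x≢ι (f u))
    g-injective {inj₂ true}  {inj₁ u} eq = contradiction eq (y≢ι (f u))
    g-injective {inj₂ false} {inj₂ false} eq = refl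
    g-injective {inj₂ false} {inj₂ true}  eq = contradiction eq x≢y
    g-injective {inj₂ true}  {inj₂ false} eq = contradiction (sym eq) x≢y
    g-injective {inj₂ true}  {inj₂ true}  eq = refl
    spanned : ∀ i j v → T (coEdge H (inj₂ i) (inj₂ j) (inj₁ v)) →
              T (edge G (g (inj₂ i)) (g (inj₂ j)) (ι (f v)))
    spanned false true  v _ = ι∈N (f v)
    spanned true  false v _ = subst T (edge-swap G x y (ι (f v))) (ι∈N (f v))
    g-edge : ∀ a b c → T (coEdge H a b c) → T (edge G (g a) (g b) (g c))
    g-edge (inj₁ u) (inj₁ v) (inj₁ w) e = f-edge u v w e
    g-edge (inj₂ i) (inj₂ j) (inj₁ v) e = spanned i j v e
    -- `coEdge` is `i xor j` wherever the old vertex stands, so `e` fits `spanned` as it is and only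
    -- the 3-edge of `G` is permuted.
    g-edge (inj₁ v) (inj₂ i) (inj₂ j) e =
      subst T (sym (edge-rotate G (ι (f v)) (g (inj₂ i)) (g (inj₂ j)))) (spanned i j v e)
    g-edge (inj₂ i) (inj₁ v) (inj₂ j) e =
      subst T (edge-swap G (ι (f v)) (g (inj₂ i)) (g (inj₂ j)))
        (subst T (sym (edge-rotate G (ι (f v)) (g (inj₂ i)) (g (inj₂ j)))) (spanned i j v e))

-- The maximality of `c` is tested on `G` induced on exactly `d` common neighbours of the vertices 0
-- and 1. Truncated subtraction is harmless: for 2d < n the codegree claimed is 0.
coex-coSpanned-bound : ∀ {U : Set} {H : ThreeGraph U} k {d c} →
  Achieves (2 ℕ.+ k) (coSpanned H) d → IsCoex d H c → d ℕ.+ d ℕ.≤ (2 ℕ.+ k) ℕ.+ c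
coex-coSpanned-bound {H = H} k {d} {c} (G , deg , F-free) (_ , maximal) =
  ℕ.≤-trans (ℕ.m≤n+m∸n (d ℕ.+ d) (2 ℕ.+ k)) (ℕ.+-monoʳ-≤ (2 ℕ.+ k) (maximal _ achieves))
  where
  0≢1 : Fin.zero ≢ Fin.suc {suc k} zero
  0≢1 ()
  S = choose (edge G zero (suc zero)) d (deg zero (suc zero) 0≢1)
  ι = proj₁ S
  achieves : Achieves d H (d ℕ.+ d ℕ.∸ (2 ℕ.+ k))
  achieves = induced G ι ,
    -- The bound from `choose`, applied to the neighbourhood of `ι u` and `ι v` in `G`, counts their
    -- common neighbours inside the image of `ι`.
    (λ u v u≢v → ℕ.m≤n+o⇒m∸n≤o _ (2 ℕ.+ k) (ℕ.≤-trans
      (ℕ.+-monoˡ-≤ d (deg (ι u) (ι v) (u≢v ∘ proj₁ (proj₂ S))))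
      (proj₂ (proj₂ (proj₂ S)) (edge G (ι u) (ι v))))) ,
    F-free ∘ induced-contains⇒contains-coSpanned G H 0≢1 ι
      (proj₁ (proj₂ S)) (proj₁ (proj₂ (proj₂ S)))

achieved≤order : ∀ {W : Set} {F : ThreeGraph W} k {d} →
  Achieves (2 ℕ.+ k) F d → d ℕ.≤ 2 ℕ.+ k
achieved≤order k (G , deg , _) =
  ℕ.≤-trans (deg zero (suc zero) λ ()) (∣p∣≤n (neighbourhood G zero (suc zero)))

-- Arithmetic of fractions of natural numbers.

fromℚᵘ-homo-+ : ∀ p q → fromℚᵘ (p ℚᵘ.+ q) ≡ fromℚᵘ p + fromℚᵘ q
fromℚᵘ-homo-+ p q = toℚᵘ-injective (ℚᵘ.≃-trans (toℚᵘ-fromℚᵘ (p ℚᵘ.+ q))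
  (ℚᵘ.≃-sym (ℚᵘ.≃-trans (toℚᵘ-homo-+ (fromℚᵘ p) (fromℚᵘ q))
    (ℚᵘ.+-cong (toℚᵘ-fromℚᵘ p) (toℚᵘ-fromℚᵘ q)))))

fromℚᵘ-homo-* : ∀ p q → fromℚᵘ (p ℚᵘ.* q) ≡ fromℚᵘ p * fromℚᵘ q
fromℚᵘ-homo-* p q = toℚᵘ-injective (ℚᵘ.≃-trans (toℚᵘ-fromℚᵘ (p ℚᵘ.* q))
  (ℚᵘ.≃-sym (ℚᵘ.≃-trans (toℚᵘ-homo-* (fromℚᵘ p) (fromℚᵘ q))
    (ℚᵘ.*-cong (toℚᵘ-fromℚᵘ p) (toℚᵘ-fromℚᵘ q)))))

/-mono-≤ : ∀ a b k l → a ℕ.* suc l ℕ.≤ b ℕ.* suc k → + a / suc k ≤ + b / suc l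
/-mono-≤ a b k l h = toℚᵘ-cancel-≤ (begin
  toℚᵘ (+ a / suc k)  ≃⟨ toℚᵘ-fromℚᵘ (mkℚᵘ (+ a) k) ⟩
  mkℚᵘ (+ a) k        ≤⟨ ℚᵘ.*≤* (ℤ.≤-trans (ℤ.≤-reflexive (sym (ℤ.pos-* a (suc l))))
                           (ℤ.≤-trans (ℤ.+≤+ h) (ℤ.≤-reflexive (ℤ.pos-* b (suc k))))) ⟩
  mkℚᵘ (+ b) l        ≃⟨ toℚᵘ-fromℚᵘ (mkℚᵘ (+ b) l) ⟨
  toℚᵘ (+ b / suc l)  ∎)
  where open ℚᵘ.≤-Reasoning

/-monoˡ-≤ : ∀ {a b} k → a ℕ.≤ b → + a / suc k ≤ + b / suc k
/-monoˡ-≤ {a} {b} k a≤b = /-mono-≤ a b k k (ℕ.*-monoˡ-≤ (suc k) a≤b)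

-- `+ a / suc k` is `fromℚᵘ (mkℚᵘ (+ a) k)` by definition, so a cross-multiplied identity of
-- integers suffices and no gcd appears.
/-distribʳ-+ : ∀ a b k → + (a ℕ.+ b) / suc k ≡ + a / suc k + + b / suc k
/-distribʳ-+ a b k = trans
  (fromℚᵘ-cong {mkℚᵘ (+ (a ℕ.+ b)) k} {mkℚᵘ (+ a) k ℚᵘ.+ mkℚᵘ (+ b) k}
    (ℚᵘ.*≡* (solve 3 (λ a b k → (a :+ b) :* (k :* k) := (a :* k :+ b :* k) :* k)
      refl (+ a) (+ b) (+ suc k))))
  (fromℚᵘ-homo-+ (mkℚᵘ (+ a) k) (mkℚᵘ (+ b) k))
  where open ℤ.+-*-Solver

/-*-cancel : ∀ a j k → (+ a / suc j) * (+ suc j / suc k) ≡ + a / suc k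
/-*-cancel a j k = trans
  (sym (fromℚᵘ-homo-* (mkℚᵘ (+ a) j) (mkℚᵘ (+ suc j) k)))
  (fromℚᵘ-cong {mkℚᵘ (+ a) j ℚᵘ.* mkℚᵘ (+ suc j) k} {mkℚᵘ (+ a) k}
    (ℚᵘ.*≡* (solve 3 (λ a j k → a :* j :* k := a :* (j :* k))
      refl (+ a) (+ suc j) (+ suc k))))
  where open ℤ.+-*-Solver

n/n≡1 : ∀ k → + suc k / suc k ≡ 1ℚ
n/n≡1 k = fromℚᵘ-cong {mkℚᵘ (+ suc k) k} {ℚᵘ.1ℚᵘ}
  (ℚᵘ.*≡* (ℤ.*-comm (+ suc k) (+ 1)))

archimedean : ∀ M ε .{{_ : Positive ε}} → ∃[ L ] ∀ k → L ℕ.≤ k → + M / suc k ≤ ε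
-- Here ε = (p + 1) / (q + 1), so the claim is M (q + 1) ≤ (p + 1) (k + 1), and M (q + 1) ≤ k is
-- enough.
archimedean M ε@(mkℚ (+ suc p) q _) = M ℕ.* suc q , λ k L≤k →
  subst (+ M / suc k ≤_) (fromℚᵘ-toℚᵘ ε) (/-mono-≤ M (suc p) k q
    (ℕ.≤-trans (ℕ.≤-trans L≤k (ℕ.n≤1+n k)) (ℕ.m≤n*m (suc k) (suc p))))

-- Limits unfolded into rational inequalities.

p≤∣p∣ : ∀ p → p ≤ ∣ p ∣
p≤∣p∣ p with ≤-total 0ℚ p
... | inj₁ 0≤p = ≤-reflexive (sym (0≤p⇒∣p∣≡p 0≤p))
... | inj₂ p≤0 = ≤-trans p≤0 (0≤∣p∣ p)

∣p-q∣≤e⇒p≤q+e : ∀ p q {e} → ∣ p - q ∣ ≤ e → p ≤ q + e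
∣p-q∣≤e⇒p≤q+e p q {e} h = begin
  p            ≡⟨ solve 2 (λ p q → p := q :+ (p :- q)) refl p q ⟩
  q + (p - q)  ≤⟨ +-monoʳ-≤ q (≤-trans (p≤∣p∣ (p - q)) h) ⟩
  q + e        ∎
  where
  open ≤-Reasoning
  open +-*-Solver

∣p-q∣≤e⇒q≤p+e : ∀ p q {e} → ∣ p - q ∣ ≤ e → q ≤ p + e
∣p-q∣≤e⇒q≤p+e p q {e} h = ∣p-q∣≤e⇒p≤q+e q p (subst (_≤ e)
  (trans (sym (∣-p∣≡∣p∣ (p - q))) (cong ∣_∣ (solve 2 (λ p q → :- (p :- q) := q :- p) refl p q))) h)
  where open +-*-Solver

-- Half of `ε` goes to the limit and half to the tolerance within `≤ᵣ`; the latter makes `N` depend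
-- on `k`.
⟶⇒close : ∀ r x → r ⟶ x → ∀ ε .{{_ : Positive ε}} → ∃[ K ] ∀ k → K ℕ.≤ k →
  ∃[ N ] ∀ n → N ℕ.≤ n → r k ≤ seq x n + ε × seq x n ≤ r k + ε
⟶⇒close r x lim ε = K , λ k K≤k → let N , h = close k K≤k (½ * ε) in
  N , λ n N≤n → let h′ = subst (∣ r k - seq x n ∣ ≤_) halves (h n N≤n) in
    ∣p-q∣≤e⇒p≤q+e (r k) (seq x n) h′ , ∣p-q∣≤e⇒q≤p+e (r k) (seq x n) h′
  where
  instance
    posε/2 : Positive (½ * ε)
    posε/2 = pos*pos⇒pos ½ ε
  K = proj₁ (lim (½ * ε))
  close = proj₂ (lim (½ * ε))
  halves : ½ * ε + ½ * ε ≡ ε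
  halves = solve 1 (λ ε → con ½ :* ε :+ con ½ :* ε := ε) refl ε
    where open +-*-Solver

-- From the codegree inequality to the reciprocal.

⊓-pos : ∀ p q .{{_ : Positive p}} .{{_ : Positive q}} → Positive (p ⊓ q)
⊓-pos p q with ⊓-sel p q
... | inj₁ eq = ℚ.positive (subst (0ℚ ℚ.<_) (sym eq) (positive⁻¹ p))
... | inj₂ eq = ℚ.positive (subst (0ℚ ℚ.<_) (sym eq) (positive⁻¹ q))

-- For d ≥ 3, with s = (d − 2) / (n − 2) and t = coex(d, H) / (d − 2).
ratio-bound : ∀ j k c → (3 ℕ.+ j) ℕ.+ (3 ℕ.+ j) ℕ.≤ (3 ℕ.+ k) ℕ.+ c →
  let s = + suc j / suc k; t = + c / suc j in s + s ≤ 1ℚ + t * s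
ratio-bound j k c h = begin
  + suc j / suc k + + suc j / suc k  ≡⟨ /-distribʳ-+ (suc j) (suc j) k ⟨
  + (suc j ℕ.+ suc j) / suc k        ≤⟨ /-monoˡ-≤ k h′ ⟩
  + (suc k ℕ.+ c) / suc k            ≡⟨ /-distribʳ-+ (suc k) c k ⟩
  + suc k / suc k + + c / suc k      ≡⟨ cong₂ _+_ (n/n≡1 k) (sym (/-*-cancel c j k)) ⟩
  1ℚ + (+ c / suc j) * (+ suc j / suc k)  ∎
  where
  open ≤-Reasoning
  h′ : suc j ℕ.+ suc j ℕ.≤ suc k ℕ.+ c
  -- One 2 cancels against n - 2; the other is dropped from the smaller side.
  h′ = ℕ.+-cancelˡ-≤ 2 _ _ (ℕ.≤-trans (ℕ.+-monoʳ-≤ (3 ℕ.+ j) (ℕ.m≤n+m (suc j) 2)) h)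

-- Divide by δ ⊔ b, which equals `b`: as it is at least `δ`, the error e δ shrinks to at most `e`.
≤recip⊔ : ∀ {δ} (δ>0 : Positive δ) {b s e} → δ ≤ b → b * s ≤ 1ℚ + e * δ →
          0ℚ ≤ e → s ≤ recip⊔ δ δ>0 b + e
≤recip⊔ {δ} δ>0 {b} {s} {e} δ≤b bs≤ 0≤e = *-cancelˡ-≤-pos a (begin
  a * s             ≡⟨ cong (_* s) (p≤q⇒p⊔q≡q δ≤b) ⟩
  b * s             ≤⟨ bs≤ ⟩
  1ℚ + e * δ        ≤⟨ +-monoʳ-≤ 1ℚ (*-monoˡ-≤-nonNeg e (p≤p⊔q δ b)) ⟩
  1ℚ + e * a        ≡⟨ cong₂ _+_ (sym (*-inverseʳ a)) (*-comm e a) ⟩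
  a * 1/ a + a * e  ≡⟨ *-distribˡ-+ a (1/ a) e ⟨
  a * (1/ a + e)    ∎)
  where
  open ≤-Reasoning
  a = δ ⊔ b
  instance
    posa : Positive a
    posa = ℚ.positive (<-≤-trans (positive⁻¹ δ {{δ>0}}) (p≤p⊔q δ b))
    nza : ℚ.NonZero a
    nza = pos⇒nonZero a
    nne : ℚ.NonNegative e
    nne = ℚ.nonNegative 0≤e

proposition18 : (m : ℕ) (H : ThreeGraph (Fin m)) → NonEmpty H →
    (γ γ′ : ℝ) (isγ : IsCodegreeDensity H γ) →
    IsCodegreeDensity (coSpanned H) γ′ →
    γ′ ≤ᵣ recip (2ℝ -ᵣ γ) (0<2-density H γ isγ)
proposition18 m H _ γ γ′ isγ@(coex , isCoex , lim) (coex′ , isCoex′ , lim′) ε =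
  bound
  where
  positivity = 0<2-density H γ isγ
  -- The same `δ` is built into `recip`, so `limit n` below is `recip⊔` at 2 - `seq γ n` by
  -- computation.
  δ = proj₁ positivity
  instance
    δ>0 : Positive δ
    δ>0 = proj₁ (proj₂ positivity)
  N₀ = proj₁ (proj₂ (proj₂ positivity))
  δ≤2-γ : ∀ n → N₀ ℕ.≤ n → δ ≤ + 2 / 1 - seq γ n
  δ≤2-γ n N₀≤n = subst (_≤ + 2 / 1 - seq γ n) (+-identityˡ δ)
    (proj₂ (proj₂ (proj₂ positivity)) n N₀≤n)
  ε/2 = ½ * ε
  instance
    ε/2>0 : Positive ε/2
    ε/2>0 = pos*pos⇒pos ½ ε
  -- The first bound lets two errors `e` fit into `ε/2` in `combine`; the second meets the
  -- hypothesis of `≤recip⊔` in `core`.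
  e = (½ * ε/2) ⊓ (ε/2 * δ)
  instance
    e>0 : Positive e
    e>0 = ⊓-pos (½ * ε/2) (ε/2 * δ)
            {{pos*pos⇒pos ½ ε/2}} {{pos*pos⇒pos ε/2 δ}}
  e+e≤ε/2 : e + e ≤ ε/2
  e+e≤ε/2 = ≤-trans (+-mono-≤ (p⊓q≤p (½ * ε/2) (ε/2 * δ)) (p⊓q≤p (½ * ε/2) (ε/2 * δ)))
    (≤-reflexive (solve 1 (λ x → con ½ :* x :+ con ½ :* x := x) refl ε/2))
    where open +-*-Solver

  H-close = ⟶⇒close (λ k → + coex k / suc k) γ lim e
  F-close = ⟶⇒close (λ k → + coex′ k / suc k) γ′ lim′ e
  K  = proj₁ H-close
  K′ = proj₁ F-close
  L  = proj₁ (archimedean (3 ℕ.+ K) e)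
  -- One fixed order n = k + 3 is enough: it makes `d` / (n - 2) approximate γ′ and (3 + K) / (n -
  -- 2) negligible.
  k  = K′ ℕ.⊔ L
  small : + (3 ℕ.+ K) / suc k ≤ e
  small = proj₂ (archimedean (3 ℕ.+ K) e) k (ℕ.m≤n⊔m K′ L)
  d  = coex′ k
  N₁ = proj₁ (proj₂ F-close k (ℕ.m≤m⊔n K′ L))
  γ′≤ : ∀ n → N₁ ℕ.≤ n → seq γ′ n ≤ + d / suc k + e
  γ′≤ n N₁≤n = proj₂ (proj₂ (proj₂ F-close k (ℕ.m≤m⊔n K′ L)) n N₁≤n)

  limit : ℕ → ℚ
  limit n = seq (recip (2ℝ -ᵣ γ) positivity) n

  Bound : Set
  Bound = ∃[ N ] ∀ n → N ℕ.≤ n → seq γ′ n ≤ limit n + ε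

  -- `s` stands in for `d` / (n - 2): it is 0 for small `d` and (d - 2) / (n - 2) for large `d`.
  combine : ∀ n s → s ≤ limit n + ε/2 → + d / suc k ≤ s + e → N₁ ℕ.≤ n →
            seq γ′ n ≤ limit n + ε
  combine n s s≤ r≤ N₁≤n = begin
    seq γ′ n                 ≤⟨ γ′≤ n N₁≤n ⟩
    + d / suc k + e          ≤⟨ +-monoˡ-≤ e r≤ ⟩
    s + e + e                ≡⟨ +-assoc s e e ⟩
    s + (e + e)              ≤⟨ +-mono-≤ s≤ e+e≤ε/2 ⟩
    limit n + ε/2 + ε/2      ≡⟨ solve 2 (λ l ε → l :+ con ½ :* ε :+ con ½ :* ε := l :+ ε)
                                  refl (limit n) ε ⟩
    limit n + ε              ∎
    where
    open ≤-Reasoning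
    open +-*-Solver

  -- Here `d` may be too small for coex(d, H) to be near its limit, but then `d` / (n - 2) ≤ `e`
  -- anyway.
  low : d ℕ.≤ 3 ℕ.+ K → Bound
  low d≤ = N₀ ℕ.⊔ N₁ , λ n N≤n → combine n 0ℚ
    (≤recip⊔ δ>0 {e = ε/2} (δ≤2-γ n (ℕ.m⊔n≤o⇒m≤o N₀ N₁ N≤n))
      (≤-trans (≤-reflexive (*-zeroʳ (+ 2 / 1 - seq γ n)))
        (<⇒≤ (positive⁻¹ _ {{pos+pos⇒pos 1ℚ (ε/2 * δ) {{pos*pos⇒pos ε/2 δ}}}})))
      (<⇒≤ (positive⁻¹ ε/2)))
    (≤-trans (/-monoˡ-≤ k d≤) (≤-trans small (≤-reflexive (sym (+-identityˡ e)))))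
    (ℕ.m⊔n≤o⇒n≤o N₀ N₁ N≤n)

  -- Order `d` has index j = d - 3 in the sequence for `H`, so K ≤ j makes `t` close to γ.
  high : ∀ j → d ≡ 3 ℕ.+ j → K ℕ.≤ j → Bound
  high j d≡ K≤j = N₀ ℕ.⊔ (N₁ ℕ.⊔ N₂) , λ n N≤n →
    let N₀≤n  = ℕ.m⊔n≤o⇒m≤o N₀ (N₁ ℕ.⊔ N₂) N≤n
        N₁₂≤n = ℕ.m⊔n≤o⇒n≤o N₀ (N₁ ℕ.⊔ N₂) N≤n
    in combine n s
      (≤recip⊔ δ>0 {e = ε/2} (δ≤2-γ n N₀≤n)
        (core n (ℕ.m⊔n≤o⇒n≤o N₁ N₂ N₁₂≤n)) (<⇒≤ (positive⁻¹ ε/2)))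
      r≤ (ℕ.m⊔n≤o⇒m≤o N₁ N₂ N₁₂≤n)
    where
    open ≤-Reasoning
    s = + suc j / suc k
    t = + coex j / suc j
    achieves : Achieves (3 ℕ.+ k) (coSpanned H) (3 ℕ.+ j)
    achieves = subst (Achieves (3 ℕ.+ k) (coSpanned H)) d≡ (proj₁ (isCoex′ k))
    instance
      s≥0 : ℚ.NonNegative s
      s≥0 = normalize-nonNeg (suc j) (suc k)
    s≤1 : s ≤ 1ℚ
    s≤1 = ≤-trans (/-monoˡ-≤ k (ℕ.+-cancelˡ-≤ 2 _ _
      (achieved≤order {F = coSpanned H} (suc k) achieves))) (≤-reflexive (n/n≡1 k))
    -- Replacing `d` by d - 2 costs 2 / (n - 2), which `small` covers since 2 ≤ 3 + K.
    r≤ : + d / suc k ≤ s + e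
    r≤ = begin
      + d / suc k                ≡⟨ cong (λ d → + d / suc k) (trans d≡ (ℕ.+-comm 2 (suc j))) ⟩
      + (suc j ℕ.+ 2) / suc k    ≡⟨ /-distribʳ-+ (suc j) 2 k ⟩
      s + + 2 / suc k            ≤⟨ +-monoʳ-≤ s (≤-trans (/-monoˡ-≤ k (ℕ.m≤m+n 2 (suc K))) small) ⟩
      s + e                      ∎
    N₂ = proj₁ (proj₂ H-close j K≤j)
    -- Replacing `t` by g + e in s + s ≤ 1 + t s leaves the error e s, at most `e` because s ≤ 1.
    core : ∀ n → N₂ ℕ.≤ n → (+ 2 / 1 - seq γ n) * s ≤ 1ℚ + ε/2 * δ
    core n N₂≤n = begin
      (+ 2 / 1 - g) * s        ≡⟨ solve 2 (λ g s → (con (+ 2 / 1) :- g) :* s := s :+ s :- g :* s)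
                                    refl g s ⟩
      s + s - g * s            ≤⟨ +-monoˡ-≤ (- (g * s)) (ratio-bound j k (coex j)
                                    (coex-coSpanned-bound {H = H} (suc k) achieves (isCoex j))) ⟩
      1ℚ + t * s - g * s       ≤⟨ +-monoˡ-≤ (- (g * s)) (+-monoʳ-≤ 1ℚ (*-monoʳ-≤-nonNeg s t≤)) ⟩
      1ℚ + (g + e) * s - g * s ≡⟨ solve 3 (λ g e s → con 1ℚ :+ (g :+ e) :* s :- g :* s
                                    := con 1ℚ :+ e :* s) refl g e s ⟩
      1ℚ + e * s               ≤⟨ +-monoʳ-≤ 1ℚ (*-monoˡ-≤-nonNeg e {{pos⇒nonNeg e}} s≤1) ⟩
      1ℚ + e * 1ℚ              ≡⟨ cong (λ x → 1ℚ + x) (*-identityʳ e) ⟩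
      1ℚ + e                   ≤⟨ +-monoʳ-≤ 1ℚ (p⊓q≤q (½ * ε/2) (ε/2 * δ)) ⟩
      1ℚ + ε/2 * δ             ∎
      where
      open +-*-Solver
      g = seq γ n
      t≤ : t ≤ g + e
      t≤ = proj₁ (proj₂ (proj₂ H-close j K≤j) n N₂≤n)

  bound : Bound
  bound = [ low , (λ ≤d → high (d ℕ.∸ 3)
    (sym (ℕ.m+[n∸m]≡n (ℕ.≤-trans (ℕ.m≤m+n 3 K) ≤d))) (ℕ.∸-monoˡ-≤ 3 ≤d)) ]′
    (ℕ.≤-total d (3 ℕ.+ K))
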